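{- Let $G$ be a 2-arc-colored directed multigraph. Then $G$ is PC Euler if and only if $G$ is color-balanced and PC trail-connected. Moreover, if $G$ is PC Euler, a PC Euler trail of $G$ can be constructed in time polynomial in the size of $G$.
   Context: A directed multigraph $G$ is $c$-arc-colored if it comes with an arbitrary (not necessarily proper) map $\phi: A(G)\to [c]=\{1,\dots,c\}$. All walks and trails are directed; a trail is a walk with no repeated arc. A walk $v_1v_2\dots v_p$ is properly colored (PC) if $\phi(v_iv_{i+1})\neq\phi(v_{i+1}v_{i+2})$ for all $i\in[p-2]$, and, if it is closed, additionally the first and last arcs have different colors. $G$ is PC Euler if it has a PC Euler trail, i.e. a PC closed trail containing every arc of $G$. For a vertex $v$ and color $i$, $d^-_{i,G}(v)$ (resp. $d^+_{i,G}(v)$) is the number of arcs of color $i$ entering (resp. leaving) $v$. In a 2-arc-colored multigraph, a vertex $v$ is color-balanced iff $d^+_{i,G}(v)=d^-_{3-i,G}(v)$ for $i\in\{1,2\}$, and $G$ is color-balanced if all its vertices are. $G$ is PC trail-connected if for every ordered pair of arcs $f_1,f_2$ of $G$ there is a PC trail whose first arc is $f_1$ and whose last arc is $f_2$.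
   Formalization: In "PC trail-connected" the trail from f1 to f2 need only have consecutive arcs of different colors, even if it is closed; also requiring first and last arcs to differ would make the equivalence false (u→v→x→u→y→z→u colored 1,2,1,2,1,2 with f1=uv, f2=xu). -}

module Defs where

open import Data.Fin using (Fin; toℕ; opposite)
open import Data.Fin.Properties using (_≟_)
open import Data.List using (List; []; _∷_; head; last; length; filter; allFin; map)
open import Data.List.Membership.Propositional using (_∈_)
open import Data.List.Relation.Unary.Linked using (Linked)
open import Data.List.Relation.Unary.Unique.Propositional using (Unique)
open import Data.Maybe using (just)
open import Data.Maybe.Relation.Binary.Connected using (Connected)
open import Data.Nat using (ℕ; zero; suc; _+_)
open import Data.Product using (_×_; ∃-syntax)
import Data.Vec as Vec
open Vec using (Vec; _[_]≔_)
open import Relation.Binary.PropositionalEquality using (_≡_; _≢_)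
open import Relation.Nullary.Decidable using (_×-dec_)

-- Parallel arcs are distinct elements of Fin arcs; loops are not excluded.
record ColoredMultigraph (c : ℕ) : Set where
  field
    vertices : ℕ
    arcs     : ℕ
    src      : Fin arcs → Fin vertices
    tgt      : Fin arcs → Fin vertices
    color    : Fin arcs → Fin c

  Vertex Arc : Set
  Vertex = Fin vertices
  Arc    = Fin arcs

  size : ℕ
  size = vertices + arcs

  outdeg indeg : Fin c → Vertex → ℕ
  outdeg i v = length (filter (λ a → (color a ≟ i) ×-dec (src a ≟ v)) (allFin arcs))
  indeg  i v = length (filter (λ a → (color a ≟ i) ×-dec (tgt a ≟ v)) (allFin arcs))

  Follows DifferentColor : Arc → Arc → Set
  Follows a b        = tgt a ≡ src b
  DifferentColor a b = color a ≢ color b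

  -- A walk is given by its sequence of arcs, since with parallel arcs the
  -- vertex sequence does not determine it.  The empty list is the arcless walk.
  IsTrail : List Arc → Set
  IsTrail t = Linked Follows t × Unique t

  IsPCTrail : List Arc → Set
  IsPCTrail t = IsTrail t × Linked DifferentColor t

  -- `Connected R (last t) (head t)` relates the last arc to the first one, and
  -- holds trivially for the empty list.
  IsPCClosedTrail : List Arc → Set
  IsPCClosedTrail t =
    IsPCTrail t
    × Connected Follows (last t) (head t)
    × Connected DifferentColor (last t) (head t)

  IsPCEulerTrail : List Arc → Set
  IsPCEulerTrail t = IsPCClosedTrail t × (∀ a → a ∈ t)

  PCEuler : Set
  PCEuler = ∃[ t ] IsPCEulerTrail t

  -- The connecting trail is regarded as an open one: no condition relates the
  -- colors of f₂ and f₁, even if f₂ happens to end where f₁ starts.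
  PCTrailConnected : Set
  PCTrailConnected =
    ∀ f₁ f₂ → ∃[ t ] (IsPCTrail t × head t ≡ just f₁ × last t ≡ just f₂)

-- On Fin 2, `opposite` exchanges the two colors: i ↦ 3 - i on {1, 2}.
ColorBalanced : ColoredMultigraph 2 → Set
ColorBalanced G = ∀ v i → outdeg i v ≡ indeg (opposite i) v
  where open ColoredMultigraph G

-- Model of computation: N. D. Jones' language WHILE (Computability and
-- Complexity from a Programming Perspective, 1997), without its equality test.
-- It is Turing complete, and its polynomial-time computable functions are
-- those of Turing machines.  Constructing a pair takes constant time because
-- it stores two pointers; components may be shared.

infixr 5 _·_

data Tree : Set where
  nil : Tree
  _·_ : Tree → Tree → Tree

hd tl : Tree → Tree
hd nil     = nil
hd (x · _) = x
tl nil     = nil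
tl (_ · y) = y

data Expr (k : ℕ) : Set where
  var   : Fin k → Expr k
  nilᵉ  : Expr k
  consᵉ : Expr k → Expr k → Expr k
  hdᵉ   : Expr k → Expr k
  tlᵉ   : Expr k → Expr k

infix  6 _≔_
infixr 5 _⨾_

data Cmd (k : ℕ) : Set where
  _≔_           : Fin k → Expr k → Cmd k
  _⨾_           : Cmd k → Cmd k → Cmd k
  while_repeat_ : Expr k → Cmd k → Cmd k

Store : ℕ → Set
Store k = Vec Tree k

eval : ∀ {k} → Expr k → Store k → Tree
eval (var x)     s = Vec.lookup s x
eval nilᵉ        s = nil
eval (consᵉ e f) s = eval e s · eval f s
eval (hdᵉ e)     s = hd (eval e s)
eval (tlᵉ e)     s = tl (eval e s)

evalTime : ∀ {k} → Expr k → ℕ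
evalTime (var _)     = 1
evalTime nilᵉ        = 1
evalTime (consᵉ e f) = suc (evalTime e + evalTime f)
evalTime (hdᵉ e)     = suc (evalTime e)
evalTime (tlᵉ e)     = suc (evalTime e)

-- ⟨ C , s ⟩⇓ s′ [ τ ] : started in store s, the command C terminates in store
-- s′ after τ steps.  The value nil counts as false, every pair as true.
infix 4 ⟨_,_⟩⇓_[_]

data ⟨_,_⟩⇓_[_] {k} : Cmd k → Store k → Store k → ℕ → Set where
  assign : ∀ {x e s} →
    ⟨ x ≔ e , s ⟩⇓ s [ x ]≔ eval e s [ suc (evalTime e) ]
  seq : ∀ {C D s s′ s″ τ τ′} →
    ⟨ C , s ⟩⇓ s′ [ τ ] →
    ⟨ D , s′ ⟩⇓ s″ [ τ′ ] →
    ⟨ C ⨾ D , s ⟩⇓ s″ [ suc (τ + τ′) ]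
  while-false : ∀ {e C s} →
    eval e s ≡ nil →
    ⟨ while e repeat C , s ⟩⇓ s [ suc (evalTime e) ]
  while-true : ∀ {e C s s′ s″ x y τ τ′} →
    eval e s ≡ x · y →
    ⟨ C , s ⟩⇓ s′ [ τ ] →
    ⟨ while e repeat C , s′ ⟩⇓ s″ [ τ′ ] →
    ⟨ while e repeat C , s ⟩⇓ s″ [ suc (evalTime e + τ + τ′) ]

-- The first variable carries the input and the output; all other variables
-- are initialised to nil.
record Program : Set where
  field
    auxiliary : ℕ
    body      : Cmd (suc auxiliary)

-- Computes P d d′ τ : on input d, the program P halts with output d′ after τ steps.
Computes : Program → Tree → Tree → ℕ → Set
Computes P d d′ τ =
  ∃[ s ] (⟨ body , d Vec.∷ Vec.replicate auxiliary nil ⟩⇓ s [ τ ] × Vec.head s ≡ d′)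
  where open Program P

encodeℕ : ℕ → Tree
encodeℕ zero    = nil
encodeℕ (suc n) = nil · encodeℕ n

encodeFin : ∀ {n} → Fin n → Tree
encodeFin i = encodeℕ (toℕ i)

encodeList : List Tree → Tree
encodeList []       = nil
encodeList (x ∷ xs) = x · encodeList xs

module _ {c} (G : ColoredMultigraph c) where
  open ColoredMultigraph G

  encodeArc : Arc → Tree
  encodeArc a = encodeFin a · encodeFin (src a) · encodeFin (tgt a) · encodeFin (color a)

  -- Unary numerals keep this of polynomial length in `size`.
  encodeGraph : Tree
  encodeGraph = encodeℕ vertices · encodeList (map encodeArc (allFin arcs))

  encodeTrail : List Arc → Tree
  encodeTrail t = encodeList (map encodeFin t)

{-# OPTIONS --safe #-}

-- Replace each vertex v by its two ports (v, i), and let an arc of color i from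
-- u to v lead from (u, i) to (v, 3 - i).  Properly colored walks become ordinary
-- walks, and color balance becomes equality of in- and outdegree at every port,
-- so the theorem is the directed Euler theorem for ports.  An Euler trail is built
-- by the stack version of Hierholzer's algorithm: extend the trail on the stack
-- while some unused arc continues it, otherwise move its last arc to the output.
-- Correctness of the program that does this also yields sufficiency.
module Submission where

open import Defs
open import Data.Nat using (ℕ; _+_; _*_; _^_; _≤_)
open import Data.Product using (_×_; ∃-syntax)
open import Function.Bundles using (_⇔_)
open ColoredMultigraph using (size; IsPCEulerTrail; PCEuler; PCTrailConnected)

open import Data.Fin using (Fin; zero; suc; toℕ; opposite)
open import Data.Fin.Properties using (_≟_; opposite-involutive; opposite-prop; toℕ<n; toℕ-injective)
open import Data.List using (List; []; _∷_; _++_; [_]; _ʳ++_; map; head; last; length; filter; allFin)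
open import Data.List.Properties
  using (filter-accept; filter-≐; ++-assoc; ++-identityʳ; length-++; length-tabulate)
open import Data.List.Membership.Propositional using (_∈_)
open import Data.List.Membership.Propositional.Properties
  using (∈-∃++; ∈-++⁻; ∈-allFin; ∈-map⁻; ∈-filter⁻; ∈-insert)
open import Data.List.Membership.Propositional.Properties.WithK using (unique∧set⇒bag)
open import Data.List.Relation.Binary.BagAndSetEquality using (∼bag⇒↭)
open import Data.List.Relation.Binary.Permutation.Propositional
  using (_↭_; ↭-refl; ↭-sym; ↭-trans; ↭-prep; ↭-swap; ↭-reflexive; ↭⇒↭ₛ; module PermutationReasoning)
open import Data.List.Relation.Binary.Permutation.Propositional.Properties
  using (∈-resp-↭; map⁺; shift; drop-∷; ++-comm; ++⁺ʳ; ++⁺ˡ; filter-↭; ↭-length; ++↭ʳ++)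
import Data.List.Relation.Binary.Permutation.Setoid.Properties as Permutationₛ
open import Data.List.Relation.Unary.All using ([]; _∷_)
open import Data.List.Relation.Unary.All.Properties using (++⁻ˡ)
open import Data.List.Relation.Unary.AllPairs using ([]; _∷_)
open import Data.List.Relation.Unary.Any using (here; there)
open import Data.List.Relation.Unary.Linked using (Linked; []; [-]; _∷_)
open import Data.List.Relation.Unary.Unique.Propositional using (Unique)
open import Data.List.Relation.Unary.Unique.Propositional.Properties using (allFin⁺)
open import Data.Maybe using (just)
open import Data.Maybe.Relation.Binary.Connected using (just; nothing)
open import Data.Nat using (zero; suc; _∸_; _≤?_; s≤s; z≤n)
open import Data.Nat.Properties
  using ( suc-injective; 0∸n≡0; ≤-refl; ≤-reflexive; ≤-trans; ≤-antisym; ≤-pred; <⇒≤; n≤1+n; m≤m+n; m≤n+m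
        ; m+n≤o⇒m≤o; m∸n≤m; m≤n⇒m∸n≡0; m∸n≡0⇒m≤n; +-suc; +-comm; +-assoc; +-mono-≤; +-monoˡ-≤; +-monoʳ-≤
        ; *-mono-≤; *-monoˡ-≤; module ≤-Reasoning)
open import Data.Nat.Tactic.RingSolver using (solve-∀)
open import Data.Product using (_,_; proj₁; proj₂)
open import Data.Product.Properties using (≡-dec)
open import Data.Sum using (inj₁; inj₂)
import Data.Vec as Vec
open import Function using (_∘_; mk⇔)
open import Relation.Binary.Definitions using (DecidableEquality)
open import Relation.Binary.PropositionalEquality
  using (_≡_; _≢_; refl; sym; trans; cong; cong₂; subst; setoid)
open import Relation.Nullary using (¬_; Dec; yes; no; contradiction)
open import Relation.Nullary.Decidable using (_×-dec_)
open import Relation.Unary using (Decidable)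

-- Lists, multiplicities and permutations.

module _ {A : Set} where

  last-∷ʳ : ∀ (xs : List A) x → last (xs ++ [ x ]) ≡ just x
  last-∷ʳ []           x = refl
  last-∷ʳ (_ ∷ [])     x = refl
  last-∷ʳ (_ ∷ y ∷ xs) x = last-∷ʳ (y ∷ xs) x

  filter-map-length : ∀ {B : Set} {P : B → Set} (P? : Decidable P) (f : A → B) xs →
    length (filter P? (map f xs)) ≡ length (filter (P? ∘ f) xs)
  filter-map-length P? f [] = refl
  filter-map-length P? f (x ∷ xs) with P? (f x)
  ... | yes _ = cong suc (filter-map-length P? f xs)
  ... | no  _ = filter-map-length P? f xs

  Unique-resp-↭ : {xs ys : List A} → xs ↭ ys → Unique xs → Unique ys
  Unique-resp-↭ p = Permutationₛ.Unique-resp-↭ (setoid A) (↭⇒↭ₛ p)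

  Unique-++⁻ˡ : ∀ (xs {ys} : List A) → Unique (xs ++ ys) → Unique xs
  Unique-++⁻ˡ []       _         = []
  Unique-++⁻ˡ (x ∷ xs) (x∉ ∷ u)  = ++⁻ˡ xs x∉ ∷ Unique-++⁻ˡ xs u

  module _ (_≟ᴬ_ : DecidableEquality A) where

    count : A → List A → ℕ
    count x xs = length (filter (_≟ᴬ x) xs)

    count-injective-∷ : ∀ x z xs ys → count z (x ∷ xs) ≡ count z (x ∷ ys) → count z xs ≡ count z ys
    count-injective-∷ x z xs ys eq with x ≟ᴬ z
    ... | yes _ = suc-injective eq
    ... | no  _ = eq

    -- Equal multiplicities locate each `x` of the first list in the second, where it is cut out
    -- before recursing. This turns equalities of degrees, port by port, into one permutation.
    count⇒↭ : ∀ xs ys → (∀ z → count z xs ≡ count z ys) → xs ↭ ys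
    count⇒↭ [] [] eq = ↭-refl
    count⇒↭ [] (y ∷ ys) eq
      with () ← trans (eq y) (cong length (filter-accept (_≟ᴬ y) {xs = ys} refl))
    count⇒↭ (x ∷ xs) ys eq
      with filter (_≟ᴬ x) ys in eq′ | trans (sym (eq x)) (cong length (filter-accept (_≟ᴬ x) {xs = xs} refl))
    ... | z ∷ zs | _
      with z∈ys , refl ← ∈-filter⁻ (_≟ᴬ x) {xs = ys} (subst (z ∈_) (sym eq′) (here refl))
      with as , bs , refl ← ∈-∃++ z∈ys
      = ↭-trans (↭-prep x (count⇒↭ xs (as ++ bs) eq″)) (↭-sym (shift x as bs))
      where
      eq″ : ∀ z → count z xs ≡ count z (as ++ bs)
      eq″ z = count-injective-∷ x z xs (as ++ bs)
        (trans (eq z) (↭-length (filter-↭ (_≟ᴬ z) (shift x as bs))))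

-- Ports and color balance.

module Ports (G : ColoredMultigraph 2) where
  open ColoredMultigraph G hiding (size; IsPCEulerTrail; PCEuler; PCTrailConnected)

  Port : Set
  Port = Vertex × Fin 2

  source target : Arc → Port
  source a = src a , color a
  target a = tgt a , opposite (color a)

  _≟ₚ_ : DecidableEquality Port
  _≟ₚ_ = ≡-dec _≟_ _≟_

  opposite-≢ : (i : Fin 2) → i ≢ opposite i
  opposite-≢ zero       ()
  opposite-≢ (suc zero) ()

  ≢⇒opposite : (i j : Fin 2) → i ≢ j → opposite i ≡ j
  ≢⇒opposite zero           zero           ne = contradiction refl ne
  ≢⇒opposite zero           (suc zero)     ne = refl
  ≢⇒opposite (suc zero)     zero           ne = refl
  ≢⇒opposite (suc zero)     (suc zero)     ne = contradiction refl ne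

  port⇒follows : ∀ {a b} → target a ≡ source b → Follows a b
  port⇒follows = cong proj₁

  port⇒different : ∀ {a b} → target a ≡ source b → DifferentColor a b
  port⇒different {a} eq c = opposite-≢ (color a) (trans c (sym (cong proj₂ eq)))

  -- With only two colors, different means opposite, so the color condition determines the port
  -- exactly.
  follows⇒port : ∀ {a b} → Follows a b → DifferentColor a b → target a ≡ source b
  follows⇒port {a} {b} f d rewrite f | ≢⇒opposite (color a) (color b) d = refl

  outdeg≡count : ∀ v i → outdeg i v ≡ count _≟ₚ_ (v , i) (map source (allFin arcs))
  outdeg≡count v i = trans
    (cong length (filter-≐ _ _ ((λ { (refl , refl) → refl }) , λ { refl → refl , refl }) (allFin arcs)))
    (sym (filter-map-length (_≟ₚ (v , i)) source (allFin arcs)))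

  indeg≡count : ∀ v i → indeg (opposite i) v ≡ count _≟ₚ_ (v , i) (map target (allFin arcs))
  indeg≡count v i = trans
    (cong length (filter-≐ _ _
      ( (λ { {a} (eq , refl) → cong (tgt a ,_) (trans (cong opposite eq) (opposite-involutive i)) })
      , λ { {a} refl → sym (opposite-involutive (color a)) , refl })
      (allFin arcs)))
    (sym (filter-map-length (_≟ₚ (v , i)) target (allFin arcs)))

  -- A permutation expresses equal degrees at all ports at once and makes sense for any list of
  -- arcs; removing arcs then becomes cancellation.
  Balanced : List Arc → Set
  Balanced as = map source as ↭ map target as

  colorBalanced⇒balanced : ColorBalanced G → Balanced (allFin arcs)
  colorBalanced⇒balanced bal = count⇒↭ _≟ₚ_ _ _
    λ (v , i) → trans (sym (outdeg≡count v i)) (trans (bal v i) (indeg≡count v i))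

  balanced⇒colorBalanced : Balanced (allFin arcs) → ColorBalanced G
  balanced⇒colorBalanced bal v i =
    trans (outdeg≡count v i) (trans (↭-length (filter-↭ (_≟ₚ (v , i)) bal)) (sym (indeg≡count v i)))

  -- Walks between ports.

  -- The start is tied to `a` by an equation, since `source a` as an index would obstruct pattern
  -- matching.
  data Walk : Port → List Arc → Port → Set where
    []   : ∀ {x} → Walk x [] x
    step : ∀ {x y} a {as} → x ≡ source a → Walk (target a) as y → Walk x (a ∷ as) y

  Walk-++ : ∀ {x y z as bs} → Walk x as y → Walk y bs z → Walk x (as ++ bs) z
  Walk-++ []         w = w
  Walk-++ (step a e v) w = step a e (Walk-++ v w)

  Walk-split : ∀ {x z} as {bs} → Walk x (as ++ bs) z → ∃[ y ] (Walk x as y × Walk y bs z)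
  Walk-split []       w            = _ , [] , w
  Walk-split (a ∷ as) (step _ e w) with y , u , v ← Walk-split as w = y , step a e u , v

  -- Each inner port is the target of one arc and the source of the next, so only the two ends fail
  -- to cancel.
  Walk-balance : ∀ {x y as} → Walk x as y → y ∷ map source as ↭ x ∷ map target as
  Walk-balance []              = ↭-refl
  Walk-balance (step a refl w) = ↭-trans (↭-swap _ _ ↭-refl) (↭-prep (source a) (Walk-balance w))

  Walk-follows : ∀ {x y as} → Walk x as y → Linked Follows as
  Walk-follows []                        = []
  Walk-follows (step a _ [])             = [-]
  Walk-follows (step a _ w@(step _ e _)) = cong proj₁ e ∷ Walk-follows w

  Walk-different : ∀ {x y as} → Walk x as y → Linked DifferentColor as
  Walk-different []                        = []
  Walk-different (step a _ [])             = [-]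
  Walk-different (step a _ w@(step b e _)) = port⇒different {a} {b} e ∷ Walk-different w

  lastArc : ∀ {x y} a {as} → Walk x (a ∷ as) y → ∃[ b ] (last (a ∷ as) ≡ just b × target b ≡ y)
  lastArc a (step _ _ [])             = a , refl , refl
  lastArc a (step _ _ w@(step b _ _)) = lastArc b w

  closedWalk⇒trail : ∀ {x as} → Unique as → Walk x as x → IsPCClosedTrail as
  closedWalk⇒trail u [] = (([] , u) , []) , nothing , nothing
  closedWalk⇒trail {as = a ∷ as} u w@(step _ refl _) with b , eq , tb ← lastArc a w rewrite eq =
    ((Walk-follows w , u) , Walk-different w) ,
    just (port⇒follows {b} {a} tb) , just (port⇒different {b} {a} tb)

  linked⇒walk : ∀ {a as} → Linked Follows (a ∷ as) → Linked DifferentColor (a ∷ as) →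
    ∃[ b ] (last (a ∷ as) ≡ just b × Walk (source a) (a ∷ as) (target b))
  linked⇒walk [-] [-] = _ , refl , step _ refl []
  linked⇒walk {a} {c ∷ as} (f ∷ fs) (d ∷ ds) with b , eq , w ← linked⇒walk fs ds =
    b , eq , step a refl (subst (λ x → Walk x (c ∷ as) (target b)) (sym (follows⇒port {a} {c} f d)) w)

  trail⇒closedWalk : ∀ {a as} → IsPCClosedTrail (a ∷ as) → Walk (source a) (a ∷ as) (source a)
  trail⇒closedWalk {a} {as} (((fs , _) , ds) , cf , cd) with linked⇒walk fs ds
  ... | b , eq , w with last (a ∷ as) | eq | cf | cd
  ... | _ | refl | just f | just d = subst (Walk (source a) (a ∷ as)) (follows⇒port {b} {a} f d) w

  unique-full⇒↭ : ∀ {t} → Unique t → (∀ a → a ∈ t) → t ↭ allFin arcs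
  unique-full⇒↭ u full = ∼bag⇒↭ (unique∧set⇒bag u (allFin⁺ arcs) (mk⇔ (λ _ → ∈-allFin _) (λ _ → full _)))

  closedTrail⇒balanced : ∀ t → IsPCClosedTrail t → Balanced t
  closedTrail⇒balanced []       _ = ↭-refl
  closedTrail⇒balanced (a ∷ as) e = drop-∷ (Walk-balance (trail⇒closedWalk e))

  -- Necessity of balance and connectedness.

  module EulerTrail {t} (euler : IsPCEulerTrail G t) where

    t-unique : Unique t
    t-unique = proj₂ (proj₁ (proj₁ (proj₁ euler)))

    balanced : ColorBalanced G
    balanced = balanced⇒colorBalanced
      (↭-trans (map⁺ source (↭-sym t↭)) (↭-trans (closedTrail⇒balanced t (proj₁ euler)) (map⁺ target t↭)))
      where t↭ = unique-full⇒↭ t-unique (proj₂ euler)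

    -- A closed walk may start at any of its arcs: cut it before `f` and exchange the two pieces.
    rotation : ∀ f → f ∈ t → ∃[ as ] (Walk (source f) (f ∷ as) (source f) × (f ∷ as) ↭ t)
    rotation f f∈t with ∈-∃++ f∈t
    ... | as , bs , refl with as ++ f ∷ bs in eq | proj₁ euler
    ...   | []     | _ with () ← subst (f ∈_) eq (∈-insert as)
    ...   | c ∷ cs | e with trail⇒closedWalk e
    ...     | w rewrite sym eq with Walk-split as w
    ...       | _ , u , v@(step _ refl _) = bs ++ as , Walk-++ v u , ++-comm (f ∷ bs) as

    -- The Euler trail, rotated to begin with `f₁`, still contains `f₂`; cutting it right after `f₂`
    -- leaves the required trail.
    connected : PCTrailConnected G
    connected f₁ f₂ with rotation f₁ (proj₂ euler f₁)
    ... | cs , w , cs↭t with ∈-∃++ (∈-resp-↭ (↭-sym cs↭t) (proj₂ euler f₂))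
    ...   | as , bs , eq = trail as bs eq w (Unique-resp-↭ (↭-sym cs↭t) t-unique)
      where
      trail : ∀ {x y cs} as bs → f₁ ∷ cs ≡ as ++ f₂ ∷ bs → Walk x (f₁ ∷ cs) y → Unique (f₁ ∷ cs) →
        ∃[ t ] (IsPCTrail t × head t ≡ just f₁ × last t ≡ just f₂)
      trail [] bs refl w u = [ f₁ ] , (([-] , [] ∷ []) , [-]) , refl , refl
      trail (_ ∷ as) bs refl (step _ _ w) u with Walk-split as w
      ... | _ , w₁ , step _ refl _ =
        f₁ ∷ as ++ [ f₂ ] ,
        ((Walk-follows w′ , unique) , Walk-different w′) ,
        refl , last-∷ʳ (f₁ ∷ as) f₂
        where
        w′ : Walk (source f₁) (f₁ ∷ as ++ [ f₂ ]) (target f₂)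
        w′ = step f₁ refl (Walk-++ w₁ (step f₂ refl []))
        unique : Unique (f₁ ∷ as ++ [ f₂ ])
        unique = Unique-++⁻ˡ (f₁ ∷ as ++ [ f₂ ]) (subst Unique (sym (++-assoc (f₁ ∷ as) [ f₂ ] bs)) u)

  -- Hierholzer's algorithm on lists of arcs.

  -- A walk listed backwards: the head is its latest arc, the one to be extended or popped.
  data Stack (x : Port) : List Arc → Port → Set where
    []   : Stack x [] x
    push : ∀ {y} a {as} → Stack x as (source a) → y ≡ target a → Stack x (a ∷ as) y

  -- State of Hierholzer's algorithm: unused arcs r, the stack s of a trail from
  -- `base` to `top`, and the finished part o of the tour, from `front` to `base`.
  record Invariant (r s o : List Arc) : Set where
    field
      base top front : Port
      partition : r ++ s ++ o ↭ allFin arcs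
      stack     : Stack base s top
      output    : Walk front o base
      balance   : front ∷ map source r ↭ top ∷ map target r
      exhausted : ∀ {a b} → a ∈ o → b ∈ r → target a ≢ source b
      finished  : s ≡ [] → front ≡ base × ∃[ a ] a ∈ o

  -- With the ends of `a` as `front` and `top`, the balance field is exactly the balance of the
  -- whole graph.
  invariant-init : ∀ {a r} → a ∷ r ≡ allFin arcs → Balanced (allFin arcs) → Invariant r [ a ] []
  invariant-init {a} {r} eq bal = record
    { base     = source a
    ; top       = target a
    ; front     = source a
    ; partition = ↭-trans (++-comm r [ a ]) (↭-reflexive eq)
    ; stack     = push a [] refl
    ; output    = []
    ; balance   = subst Balanced (sym eq) bal
    ; exhausted = λ ()
    ; finished  = λ ()
    }

  -- The new arc leaves `top`, so its source cancels against the old `top` and its target becomes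
  -- the new one.
  invariant-push : ∀ {a b r r′ s o} → Invariant r (a ∷ s) o →
    target a ≡ source b → r ↭ b ∷ r′ → Invariant r′ (b ∷ a ∷ s) o
  invariant-push {a} {b} {r} {r′} {s} {o} inv ab r↭ with push a st e ← Invariant.stack inv = record
    { base     = base
    ; top       = target b
    ; front     = front
    ; partition = ↭-trans (shift b r′ (a ∷ s ++ o)) (↭-trans (↭-sym (++⁺ʳ (a ∷ s ++ o) r↭)) partition)
    ; stack     = push b (push a st (sym ab)) refl
    ; output    = output
    ; balance   = drop-∷ (begin
        source b ∷ front ∷ map source r′    ↭⟨ ↭-swap _ _ ↭-refl ⟩
        front ∷ source b ∷ map source r′    ↭⟨ ↭-prep front (map⁺ source r↭) ⟨
        front ∷ map source r                ↭⟨ balance ⟩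
        top ∷ map target r                  ↭⟨ ↭-prep top (map⁺ target r↭) ⟩
        top ∷ target b ∷ map target r′      ≡⟨ cong (_∷ _) (trans e ab) ⟩
        source b ∷ target b ∷ map target r′ ∎)
    ; exhausted = λ a∈o c∈r′ → exhausted a∈o (∈-resp-↭ (↭-sym r↭) (there c∈r′))
    ; finished  = λ ()
    }
    where
    open Invariant inv
    open PermutationReasoning

  -- A trail that cannot be continued has returned to `front`, by balance.
  stuck⇒front : ∀ {a r s o} (inv : Invariant r (a ∷ s) o) →
    (∀ {b} → b ∈ r → target a ≢ source b) → target a ≡ Invariant.front inv
  stuck⇒front {a} {r} inv stuck with push _ _ e ← Invariant.stack inv
    with ∈-resp-↭ (↭-sym (Invariant.balance inv)) (here refl)
  ... | here eq = trans (sym e) eq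
  ... | there top∈ with b , b∈r , eq ← ∈-map⁻ source top∈ = contradiction (trans (sym e) eq) (stuck b∈r)

  invariant-pop : ∀ {a r r′ s o} → Invariant r (a ∷ s) o →
    (∀ {b} → b ∈ r → target a ≢ source b) → r ↭ r′ → Invariant r′ s (a ∷ o)
  invariant-pop {a} {r} {r′} {s} {o} inv stuck r↭ with push a st e ← Invariant.stack inv = record
    { base     = base
    ; top       = source a
    ; front     = source a
    ; partition = ↭-trans (++⁺ʳ (s ++ a ∷ o) (↭-sym r↭)) (↭-trans (++⁺ˡ r (shift a s o)) partition)
    ; stack     = st
    ; output    = step a refl (subst (λ x → Walk x o base) (sym a→front) output)
    ; balance   = ↭-prep (source a) (begin
        map source r′ ↭⟨ map⁺ source r↭ ⟨
        map source r  ↭⟨ drop-∷ (subst (λ x → x ∷ _ ↭ _) (trans (sym a→front) (sym e)) balance) ⟩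
        map target r  ↭⟨ map⁺ target r↭ ⟩
        map target r′ ∎)
    ; exhausted = λ
        { (here refl) b∈r′ → stuck (∈-resp-↭ (↭-sym r↭) b∈r′)
        ; (there c∈o) b∈r′ → exhausted c∈o (∈-resp-↭ (↭-sym r↭) b∈r′) }
    ; finished  = λ { refl → bottom st , a , here refl }
    }
    where
    open Invariant inv
    open PermutationReasoning
    a→front = stuck⇒front inv stuck
    bottom : ∀ {x y} → Stack x [] y → y ≡ x
    bottom [] = refl

  -- An empty stack leaves a closed tour containing some arc `a`; trail-connectedness from `a`
  -- forces every arc into it.
  invariant-final : ∀ {r o} → PCTrailConnected G → Invariant r [] o → IsPCEulerTrail G o
  invariant-final {r} {o} conn inv with front≡base , a , a∈o ← Invariant.finished inv refl =
    closedWalk⇒trail (Unique-++⁻ˡ o unique) (subst (Walk front o) (sym front≡base) output) , full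
    where
    open Invariant inv
    o↭ = ↭-trans (++-comm o r) partition
    unique = Unique-resp-↭ (↭-sym o↭) (allFin⁺ arcs)

    reach : ∀ {a as f} → a ∈ o → Linked Follows (a ∷ as) → Linked DifferentColor (a ∷ as) →
      last (a ∷ as) ≡ just f → f ∈ o
    reach a∈o [-] [-] refl = a∈o
    reach {a} {b ∷ as} a∈o (f ∷ fs) (d ∷ ds) eq with ∈-++⁻ o (∈-resp-↭ (↭-sym o↭) (∈-allFin b))
    ... | inj₁ b∈o = reach b∈o fs ds eq
    ... | inj₂ b∈r = contradiction (follows⇒port {a} {b} f d) (exhausted a∈o b∈r)

    full : ∀ f → f ∈ o
    full f with conn a f
    ... | _ ∷ _ , ((fs , _) , ds) , refl , eq = reach a∈o fs ds eq

-- Time-bounded execution of WHILE programs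

infix 4 ⟨_,_⟩⇓_within_
-- Recording only upper bounds lets branches of different cost share one specification.
record ⟨_,_⟩⇓_within_ {k} (C : Cmd k) (s s′ : Store k) (T : ℕ) : Set where
  constructor bounded
  field
    {time} : ℕ
    run    : ⟨ C , s ⟩⇓ s′ [ time ]
    bound  : time ≤ T

module _ {k : ℕ} where

  weaken : ∀ {C : Cmd k} {s s′ T T′} → T ≤ T′ → ⟨ C , s ⟩⇓ s′ within T → ⟨ C , s ⟩⇓ s′ within T′
  weaken T≤T′ (bounded r b) = bounded r (≤-trans b T≤T′)

  cast⇓ : ∀ {C : Cmd k} {s s′ s″ T} → s′ ≡ s″ → ⟨ C , s ⟩⇓ s′ within T → ⟨ C , s ⟩⇓ s″ within T
  cast⇓ refl r = r

  infixr 5 _⨾⇓_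
  _⨾⇓_ : ∀ {C D : Cmd k} {s s′ s″ T T′} → ⟨ C , s ⟩⇓ s′ within T → ⟨ D , s′ ⟩⇓ s″ within T′ →
    ⟨ C ⨾ D , s ⟩⇓ s″ within suc (T + T′)
  bounded r b ⨾⇓ bounded r′ b′ = bounded (seq r r′) (s≤s (+-mono-≤ b b′))

  assign⇓ : ∀ {x : Fin k} {e s} → ⟨ x ≔ e , s ⟩⇓ s Vec.[ x ]≔ eval e s within suc (evalTime e)
  assign⇓ = bounded assign ≤-refl

  assign≡⇓ : ∀ {x : Fin k} {e s t} → eval e s ≡ t → ⟨ x ≔ e , s ⟩⇓ s Vec.[ x ]≔ t within suc (evalTime e)
  assign≡⇓ refl = assign⇓

  false⇓ : ∀ {e : Expr k} {C s} → eval e s ≡ nil → ⟨ while e repeat C , s ⟩⇓ s within suc (evalTime e)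
  false⇓ eq = bounded (while-false eq) ≤-refl

  true⇓ : ∀ {e : Expr k} {C s s′ s″ x y T T′} → eval e s ≡ x · y →
    ⟨ C , s ⟩⇓ s′ within T → ⟨ while e repeat C , s′ ⟩⇓ s″ within T′ →
    ⟨ while e repeat C , s ⟩⇓ s″ within suc (evalTime e + T + T′)
  true⇓ {e} eq (bounded r b) (bounded r′ b′) =
    bounded (while-true eq r r′) (s≤s (+-mono-≤ (+-monoʳ-≤ (evalTime e) b) b′))

  if⇓ : ∀ {e : Expr k} {C s s′ x y T} → eval e s ≡ x · y →
    ⟨ C , s ⟩⇓ s′ within T → eval e s′ ≡ nil →
    ⟨ while e repeat C , s ⟩⇓ s′ within suc (evalTime e + T + suc (evalTime e))
  if⇓ eq r eq′ = true⇓ eq r (false⇓ eq′)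

-- Hierholzer's algorithm as a WHILE program

record Memory : Set where
  constructor mem
  field
    out rest stk todo passed found match search left right flip : Tree
open Memory

⌊_⌋ : Memory → Store 11
⌊ μ ⌋ = out μ Vec.∷ rest μ Vec.∷ stk μ Vec.∷ todo μ Vec.∷ passed μ Vec.∷ found μ Vec.∷ match μ
  Vec.∷ search μ Vec.∷ left μ Vec.∷ right μ Vec.∷ flip μ Vec.∷ Vec.[]

pattern OUT    = zero
pattern REST   = suc OUT
pattern STK    = suc REST
pattern TODO   = suc STK
pattern PASSED = suc TODO
pattern FOUND  = suc PASSED
pattern MATCH  = suc FOUND
pattern SEARCH = suc MATCH
pattern LEFT   = suc SEARCH
pattern RIGHT  = suc LEFT
pattern FLIP   = suc RIGHT

trueᵉ : ∀ {k} → Expr k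
trueᵉ = consᵉ nilᵉ nilᵉ

srcᵉ tgtᵉ colorᵉ : ∀ {k} → Expr k → Expr k
srcᵉ e   = hdᵉ (tlᵉ e)
tgtᵉ e   = hdᵉ (tlᵉ (tlᵉ e))
colorᵉ e = tlᵉ (tlᵉ (tlᵉ e))

countdown : Cmd 11
countdown = while var LEFT repeat (LEFT ≔ tlᵉ (var LEFT) ⨾ RIGHT ≔ tlᵉ (var RIGHT))

-- Sets RIGHT to the truncated difference e₂ ∸ e₁.
subtract : Expr 11 → Expr 11 → Cmd 11
subtract e₁ e₂ = LEFT ≔ e₁ ⨾ RIGHT ≔ e₂ ⨾ countdown

-- Clears MATCH unless e₂ ≤ e₁.
require≥ : Expr 11 → Expr 11 → Cmd 11
require≥ e₁ e₂ = subtract e₁ e₂ ⨾ while var RIGHT repeat (RIGHT ≔ nilᵉ ⨾ MATCH ≔ nilᵉ)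

topᵉ curᵉ : Expr 11
topᵉ = hdᵉ (var STK)
curᵉ = hdᵉ (var TODO)

-- For want of an equality test, equality of the two ports is checked as four inequalities between
-- numerals.
testArc : Cmd 11
testArc =
  require≥ (tgtᵉ topᵉ) (srcᵉ curᵉ) ⨾
  require≥ (srcᵉ curᵉ) (tgtᵉ topᵉ) ⨾
  require≥ (var FLIP) (colorᵉ curᵉ) ⨾
  require≥ (colorᵉ curᵉ) (var FLIP)

-- Branching without `if`: the effect of one branch is undone, if need be, by a
-- loop that clears its own condition.
takeMatch : Cmd 11
takeMatch = while var MATCH repeat
  (MATCH ≔ nilᵉ ⨾ SEARCH ≔ nilᵉ ⨾ FOUND ≔ curᵉ ⨾ PASSED ≔ tlᵉ (var PASSED))

scanArc : Cmd 11
scanArc =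
  -- Once an arc has been found, `SEARCH` is `nil` and no later test can succeed.
  MATCH ≔ var SEARCH ⨾
  testArc ⨾
  PASSED ≔ consᵉ curᵉ (var PASSED) ⨾
  takeMatch ⨾
  TODO ≔ tlᵉ (var TODO)

scan : Cmd 11
scan = while var TODO repeat scanArc

-- `extend` pushes `FOUND` unconditionally. After a failed search the first removal undoes this
-- push, and the second takes off the arc moved to `OUT`.
pop : Cmd 11
pop = while var SEARCH repeat
  (SEARCH ≔ nilᵉ ⨾ STK ≔ tlᵉ (var STK) ⨾ OUT ≔ consᵉ (hdᵉ topᵉ) (var OUT) ⨾ STK ≔ tlᵉ (var STK))

extend : Cmd 11
extend =
  -- `trueᵉ` doubles as the numeral 1, so this computes the opposite color.
  subtract (colorᵉ topᵉ) trueᵉ ⨾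
  FLIP ≔ var RIGHT ⨾
  RIGHT ≔ nilᵉ ⨾
  TODO ≔ var REST ⨾
  PASSED ≔ nilᵉ ⨾
  SEARCH ≔ trueᵉ ⨾
  scan ⨾
  REST ≔ var PASSED ⨾
  STK ≔ consᵉ (var FOUND) (var STK) ⨾
  pop

tour : Cmd 11
tour = while var STK repeat extend

startTour : Cmd 11
startTour = while var TODO repeat
  (TODO ≔ nilᵉ ⨾ STK ≔ consᵉ (hdᵉ (var REST)) nilᵉ ⨾ REST ≔ tlᵉ (var REST))

hierholzer : Program
hierholzer = record
  { auxiliary = 10
  ; body      = REST ≔ tlᵉ (var OUT) ⨾ OUT ≔ nilᵉ ⨾ TODO ≔ var REST ⨾ startTour ⨾ tour
  }

-- Correctness of the comparisons.

guard : ∀ {P : Set} → Dec P → Tree → Tree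
guard (yes _) t = t
guard (no  _) t = nil

guard-yes : ∀ {P : Set} (d : Dec P) t → P → guard d t ≡ t
guard-yes (yes _) t p = refl
guard-yes (no ¬p) t p = contradiction p ¬p

guard-no : ∀ {P : Set} (d : Dec P) t → ¬ P → guard d t ≡ nil
guard-no (yes p) t ¬p = contradiction p ¬p
guard-no (no  _) t ¬p = refl

guard-nil : ∀ {P : Set} (d : Dec P) → guard d nil ≡ nil
guard-nil (yes _) = refl
guard-nil (no  _) = refl

guard-× : ∀ {P Q : Set} (d : Dec P) (e : Dec Q) t → guard e (guard d t) ≡ guard (d ×-dec e) t
guard-× (yes _) (yes _) t = refl
guard-× (yes _) (no  _) t = refl
guard-× (no  _) e       t = guard-nil e

-- The constants in the time bounds count the steps of the loop-free parts.
countdown-spec : ∀ μ m n →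
  ⟨ countdown , ⌊ record μ { left = encodeℕ m ; right = encodeℕ n } ⌋ ⟩⇓
  ⌊ record μ { left = nil ; right = encodeℕ (n ∸ m) } ⌋ within m * 9 + 2
countdown-spec μ zero    n       = false⇓ refl
-- As `tl nil` is `nil`, `RIGHT` stays at zero, in agreement with truncated subtraction.
countdown-spec μ (suc m) zero    =
  true⇓ refl (assign⇓ ⨾⇓ assign⇓)
    (cast⇓ (cong (λ n → ⌊ record μ { left = nil ; right = encodeℕ n } ⌋) (0∸n≡0 m)) (countdown-spec μ m zero))
countdown-spec μ (suc m) (suc n) = true⇓ refl (assign⇓ ⨾⇓ assign⇓) (countdown-spec μ m n)

subtract-spec : ∀ {e₁ e₂} μ m n → eval e₁ ⌊ μ ⌋ ≡ encodeℕ m →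
  eval e₂ ⌊ record μ { left = encodeℕ m } ⌋ ≡ encodeℕ n →
  ⟨ subtract e₁ e₂ , ⌊ μ ⌋ ⟩⇓ ⌊ record μ { left = nil ; right = encodeℕ (n ∸ m) } ⌋
  within 6 + evalTime e₁ + evalTime e₂ + m * 9
subtract-spec {e₁} {e₂} μ m n eq₁ eq₂ =
  weaken (≤-reflexive (lemma (evalTime e₁) (evalTime e₂) (m * 9)))
    (assign≡⇓ eq₁ ⨾⇓ assign≡⇓ eq₂ ⨾⇓ countdown-spec μ m n)
  where
  lemma : ∀ a b c → suc (suc a + suc (suc b + (c + 2))) ≡ 6 + a + b + c
  lemma = solve-∀

require≥-spec : ∀ {e₁ e₂} μ m n → eval e₁ ⌊ μ ⌋ ≡ encodeℕ m →
  eval e₂ ⌊ record μ { left = encodeℕ m } ⌋ ≡ encodeℕ n →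
  ⟨ require≥ e₁ e₂ , ⌊ μ ⌋ ⟩⇓ ⌊ record μ { left = nil ; right = nil ; match = guard (n ≤? m) (match μ) } ⌋
  within 16 + evalTime e₁ + evalTime e₂ + m * 9
require≥-spec {e₁} {e₂} μ m n eq₁ eq₂ =
  weaken (≤-reflexive (lemma (evalTime e₁) (evalTime e₂) (m * 9))) (subtract-spec μ m n eq₁ eq₂ ⨾⇓ clear)
  where
  lemma : ∀ a b c → suc (6 + a + b + c + 9) ≡ 16 + a + b + c
  lemma = solve-∀
  clear : ⟨ while var RIGHT repeat (RIGHT ≔ nilᵉ ⨾ MATCH ≔ nilᵉ) ,
            ⌊ record μ { left = nil ; right = encodeℕ (n ∸ m) } ⌋ ⟩⇓
          ⌊ record μ { left = nil ; right = nil ; match = guard (n ≤? m) (match μ) } ⌋ within 9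
  clear with n ≤? m
  ... | yes n≤m rewrite m≤n⇒m∸n≡0 n≤m = weaken (m≤m+n 2 7) (false⇓ refl)
  ... | no  n≰m with n ∸ m in eq
  ...   | zero  = contradiction (m∸n≡0⇒m≤n eq) n≰m
  ...   | suc _ = if⇓ refl (assign⇓ ⨾⇓ assign⇓) refl

-- Testing one arc against the top of the stack.

module Execution (G : ColoredMultigraph 2) where
  open ColoredMultigraph G hiding (size; IsPCEulerTrail; PCEuler; PCTrailConnected)
  open Ports G

  -- Bounds every numeral in the code of an arc, colors included.
  z : ℕ
  z = suc vertices

  tgt≤z : ∀ a → toℕ (tgt a) ≤ z
  tgt≤z a = ≤-trans (<⇒≤ (toℕ<n (tgt a))) (n≤1+n vertices)

  src≤z : ∀ a → toℕ (src a) ≤ z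
  src≤z a = ≤-trans (<⇒≤ (toℕ<n (src a))) (n≤1+n vertices)

  color≤z : ∀ a → toℕ (color a) ≤ z
  color≤z a = ≤-trans (≤-pred (toℕ<n (color a))) (s≤s z≤n)

  -- The number of the opposite color, in the form in which the program computes it.
  flipped : Arc → ℕ
  flipped a = 1 ∸ toℕ (color a)

  flipped≤z : ∀ a → flipped a ≤ z
  flipped≤z a = ≤-trans (m∸n≤m 1 (toℕ (color a))) (s≤s z≤n)

  encodeArcs : List Arc → Tree
  encodeArcs as = encodeList (map (encodeArc G) as)

  -- Nested in the order of the four tests, so that `guard-×` assembles it.
  testDec : ∀ a b → Dec (((toℕ (src b) ≤ toℕ (tgt a) × toℕ (tgt a) ≤ toℕ (src b)) ×
    toℕ (color b) ≤ flipped a) × flipped a ≤ toℕ (color b))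
  testDec a b = ((toℕ (src b) ≤? toℕ (tgt a) ×-dec toℕ (tgt a) ≤? toℕ (src b)) ×-dec
    toℕ (color b) ≤? flipped a) ×-dec flipped a ≤? toℕ (color b)

  testArc-spec : ∀ a b (μ : Memory) {s k} →
    let μ₀ = record μ { stk = encodeArc G a · s ; todo = encodeArc G b · k ; flip = encodeℕ (flipped a) } in
    ⟨ testArc , ⌊ μ₀ ⌋ ⟩⇓
    ⌊ record μ₀ { left = nil ; right = nil ; match = guard (testDec a b) (Memory.match μ) } ⌋
    within 97 + z * 36
  testArc-spec a b μ {s} {k} =
    cast⇓ (cong (λ m → ⌊ record μ₀ { left = nil ; right = nil ; match = m } ⌋) guards)
      (weaken time
        (require≥-spec μ₀ (toℕ (tgt a)) (toℕ (src b)) refl refl ⨾⇓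
         require≥-spec _ (toℕ (src b)) (toℕ (tgt a)) refl refl ⨾⇓
         require≥-spec _ (flipped a) (toℕ (color b)) refl refl ⨾⇓
         require≥-spec _ (toℕ (color b)) (flipped a) refl refl))
    where
    μ₀ = record μ { stk = encodeArc G a · s ; todo = encodeArc G b · k ; flip = encodeℕ (flipped a) }
    d₁ = toℕ (src b) ≤? toℕ (tgt a)
    d₂ = toℕ (tgt a) ≤? toℕ (src b)
    d₃ = toℕ (color b) ≤? flipped a
    d₄ = flipped a ≤? toℕ (color b)
    guards : guard d₄ (guard d₃ (guard d₂ (guard d₁ (Memory.match μ)))) ≡ guard (testDec a b) (Memory.match μ)
    guards = trans (cong (guard d₄ ∘ guard d₃) (guard-× d₁ d₂ _))
      (trans (cong (guard d₄) (guard-× (d₁ ×-dec d₂) d₃ _)) (guard-× ((d₁ ×-dec d₂) ×-dec d₃) d₄ _))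
    -- Four subtractions, each counting down from at most `z` at nine steps per unit.
    time : suc (25 + toℕ (tgt a) * 9 + suc (25 + toℕ (src b) * 9 +
        suc (22 + flipped a * 9 + (22 + toℕ (color b) * 9))))
      ≤ 97 + z * 36
    time = ≤-trans
      (s≤s (+-mono-≤ (bound 25 (tgt≤z a)) (s≤s (+-mono-≤ (bound 25 (src≤z b))
        (s≤s (+-mono-≤ (bound 22 (flipped≤z a)) (bound 22 (color≤z b))))))))
      (≤-reflexive (lemma z))
      where
      bound : ∀ c {m} → m ≤ z → c + m * 9 ≤ c + z * 9
      bound c m≤z = +-monoʳ-≤ c (*-monoˡ-≤ 9 m≤z)
      lemma : ∀ z → suc (25 + z * 9 + suc (25 + z * 9 + suc (22 + z * 9 + (22 + z * 9)))) ≡ 97 + z * 36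
      lemma = solve-∀

  test⇒match : ∀ a b → target a ≡ source b → ∀ t → guard (testDec a b) t ≡ t
  test⇒match a b eq t = guard-yes (testDec a b) t
    (((≤-reflexive (sym v) , ≤-reflexive v) , ≤-reflexive (sym c)) , ≤-reflexive c)
    where
    v = cong (toℕ ∘ proj₁) eq
    c : flipped a ≡ toℕ (color b)
    c = trans (sym (opposite-prop (color a))) (cong (toℕ ∘ proj₂) eq)

  test⇒mismatch : ∀ a b → target a ≢ source b → ∀ t → guard (testDec a b) t ≡ nil
  test⇒mismatch a b neq t = guard-no (testDec a b) t λ (((p , q) , r) , s) →
    neq (cong₂ _,_ (toℕ-injective (≤-antisym q p))
      (toℕ-injective (trans (opposite-prop (color a)) (≤-antisym s r))))

  true : Tree
  true = nil · nil

  module Scan (a : Arc) (o r s : Tree) where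

    scanning : Tree → Tree → Tree → Tree → Memory
    scanning k p f n = mem o r (encodeArc G a · s) k p f nil n nil nil (encodeℕ (flipped a))

    -- The cost of a hit, which exceeds that of a miss by 15.
    scanArc-time : ℕ
    scanArc-time = 128 + z * 36

    -- The hypothesis covers both ways to miss: the ports differ, or the search is already over.
    scanArc-miss : ∀ b {k p f n} → guard (testDec a b) n ≡ nil →
      ⟨ scanArc , ⌊ scanning (encodeArc G b · k) p f n ⌋ ⟩⇓
      ⌊ scanning k (encodeArc G b · p) f n ⌋ within scanArc-time
    scanArc-miss b {k} {p} {f} {n} eq = weaken time
      (assign⇓ ⨾⇓
       cast⇓ (cong (λ m → ⌊ record (scanning (encodeArc G b · k) p f n) { match = m } ⌋) eq)
         (testArc-spec a b (record (scanning (encodeArc G b · k) p f n) { match = n })) ⨾⇓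
       assign⇓ ⨾⇓ false⇓ refl ⨾⇓ assign⇓)
      where
      time : suc (2 + suc (97 + z * 36 + suc (5 + suc (2 + 3)))) ≤ scanArc-time
      time = m+n≤o⇒m≤o _ {15} (≤-reflexive (lemma z))
        where
        lemma : ∀ z → suc (2 + suc (97 + z * 36 + suc (5 + suc (2 + 3)))) + 15 ≡ 128 + z * 36
        lemma = solve-∀

    scanArc-hit : ∀ b {k p f} → target a ≡ source b →
      ⟨ scanArc , ⌊ scanning (encodeArc G b · k) p f true ⌋ ⟩⇓
      ⌊ scanning k p (encodeArc G b) nil ⌋ within scanArc-time
    scanArc-hit b {k} {p} {f} eq = weaken time
      (assign⇓ ⨾⇓
       cast⇓ (cong (λ m → ⌊ record (scanning (encodeArc G b · k) p f true) { match = m } ⌋) (test⇒match a b eq true))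
         (testArc-spec a b (record (scanning (encodeArc G b · k) p f true) { match = true })) ⨾⇓
       assign⇓ ⨾⇓ if⇓ refl (assign⇓ ⨾⇓ assign⇓ ⨾⇓ assign⇓ ⨾⇓ assign⇓) refl ⨾⇓ assign⇓)
      where
      time : suc (2 + suc (97 + z * 36 + suc (5 + suc (suc (1 + 13 + 2) + 3)))) ≤ scanArc-time
      time = ≤-reflexive (lemma z)
        where
        lemma : ∀ z → suc (2 + suc (97 + z * 36 + suc (5 + suc (suc (1 + 13 + 2) + 3)))) ≡ 128 + z * 36
        lemma = solve-∀

    scan-time : ℕ → ℕ
    scan-time l = l * (2 + scanArc-time) + 2

    scan-step : ∀ {k p f n x y μ} l →
      ⟨ scanArc , ⌊ scanning (x · y) p f n ⌋ ⟩⇓ ⌊ k ⌋ within scanArc-time →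
      ⟨ scan , ⌊ k ⌋ ⟩⇓ ⌊ μ ⌋ within scan-time l →
      ⟨ scan , ⌊ scanning (x · y) p f n ⌋ ⟩⇓ ⌊ μ ⌋ within scan-time (suc l)
    scan-step l r r′ = weaken (≤-reflexive (lemma scanArc-time (l * (2 + scanArc-time)))) (true⇓ refl r r′)
      where
      lemma : ∀ c d → suc (1 + c + (d + 2)) ≡ 2 + c + d + 2
      lemma = solve-∀

    scan-found : ∀ k p {f} →
      ⟨ scan , ⌊ scanning (encodeArcs k) (encodeArcs p) f nil ⌋ ⟩⇓
      ⌊ scanning nil (encodeArcs (k ʳ++ p)) f nil ⌋ within scan-time (length k)
    scan-found []      p = false⇓ refl
    scan-found (b ∷ k) p = scan-step (length k) (scanArc-miss b (guard-nil (testDec a b))) (scan-found k (b ∷ p))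

    -- Scanning reverses the list, so the arcs are tracked up to permutation. The final `SEARCH`
    -- value tells `pop` whether to act.
    data Outcome (k p : List Arc) (f : Tree) : Memory → Set where
      none : ∀ {p′} → k ++ p ↭ p′ → (∀ {b} → b ∈ k → target a ≢ source b) →
        Outcome k p f (scanning nil (encodeArcs p′) f true)
      some : ∀ b {p′} → k ++ p ↭ b ∷ p′ → target a ≡ source b →
        Outcome k p f (scanning nil (encodeArcs p′) (encodeArc G b) nil)

    scan-spec : ∀ k p f → ∃[ μ ] (Outcome k p f μ ×
      ⟨ scan , ⌊ scanning (encodeArcs k) (encodeArcs p) f true ⌋ ⟩⇓ ⌊ μ ⌋ within scan-time (length k))
    scan-spec []      p f = _ , none ↭-refl (λ ()) , false⇓ refl
    scan-spec (b ∷ k) p f with target a ≟ₚ source b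
    ... | yes eq = _ , some b (↭-prep b (++↭ʳ++ k p)) eq ,
      scan-step (length k) (scanArc-hit b eq) (scan-found k p)
    ... | no neq with scan-spec k (b ∷ p) f
    ...   | μ , outcome , r = μ , later outcome ,
      scan-step (length k) (scanArc-miss b (test⇒mismatch a b neq true)) r
      where
      later : ∀ {μ} → Outcome k (b ∷ p) f μ → Outcome (b ∷ k) p f μ
      later (none eq miss)  = none (↭-trans (↭-sym (shift b k p)) eq)
        λ { (here refl) → neq ; (there c∈k) → miss c∈k }
      later (some c eq hit) = some c (↭-trans (↭-sym (shift b k p)) eq) hit

  -- The loop building the tour.

  measure : List Arc → List Arc → ℕ
  measure r s = length r + length r + length s

  idle : (r s o : List Arc) (p f q : Tree) → Memory
  idle r s o p f q = mem (encodeTrail G o) (encodeArcs r) (encodeArcs s) nil p f nil nil nil nil q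

  unused≤arcs : ∀ {r s o} → Invariant r s o → length r ≤ arcs
  unused≤arcs {r} {s} {o} inv = begin
    length r                     ≤⟨ m≤m+n (length r) (length (s ++ o)) ⟩
    length r + length (s ++ o)   ≡⟨ length-++ r ⟨
    length (r ++ s ++ o)         ≡⟨ ↭-length (Invariant.partition inv) ⟩
    length (allFin arcs)         ≡⟨ length-tabulate _ ⟩
    arcs                         ∎
    where open ≤-Reasoning

  extend-time : ℕ
  extend-time = 62 + z * 9 + (arcs * (130 + z * 36) + 2)

  -- Here `l` is the number of arcs scanned and `t` the time of `pop`: 21 if it acts, 2 if it is
  -- skipped.
  extend-time-bound : ∀ {l t} a → l ≤ arcs → t ≤ 21 →
    suc (14 + toℕ (color a) * 9 + suc (2 + suc (2 + suc (2 + suc (2 + suc (4 +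
      suc (l * (130 + z * 36) + 2 + suc (2 + suc (4 + t))))))))) ≤ extend-time
  extend-time-bound a l≤ t≤ = ≤-trans
    (s≤s (+-mono-≤ (+-monoʳ-≤ 14 (*-monoˡ-≤ 9 (color≤z a)))
      (+-monoʳ-≤ 18 (+-mono-≤ (+-monoˡ-≤ 2 (*-monoˡ-≤ (130 + z * 36) l≤)) (+-monoʳ-≤ 8 t≤)))))
    (≤-reflexive (lemma (z * 9) (arcs * (130 + z * 36) + 2)))
    where
    lemma : ∀ c d → suc (14 + c + (18 + (d + (8 + 21)))) ≡ 62 + c + d
    lemma = solve-∀

  -- A failed scan realizes `invariant-pop`, a successful one `invariant-push`. `p`, `f` and `q` are
  -- leftovers of the previous pass.
  extend-spec : ∀ {a r s o} p f q → Invariant r (a ∷ s) o →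
    ∃[ r′ ] ∃[ s′ ] ∃[ o′ ] ∃[ f′ ] ∃[ q′ ]
      (Invariant r′ s′ o′ × suc (measure r′ s′) ≡ measure r (a ∷ s) ×
       ⟨ extend , ⌊ idle r (a ∷ s) o p f q ⌋ ⟩⇓ ⌊ idle r′ s′ o′ (encodeArcs r′) f′ q′ ⌋ within extend-time)
  extend-spec {a} {r} {s} {o} p f q inv
    with Scan.scan-spec a (encodeTrail G o) (encodeArcs r) (encodeArcs s) r [] f
  ... | _ , Scan.none {r′} eq miss , run = r′ , s , a ∷ o , _ , _ ,
    invariant-pop inv miss r↭r′ , size-eq ,
    weaken (extend-time-bound a (unused≤arcs inv) ≤-refl)
      (subtract-spec (idle r (a ∷ s) o p f q) (toℕ (color a)) 1 refl refl ⨾⇓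
       assign⇓ ⨾⇓ assign⇓ ⨾⇓ assign⇓ ⨾⇓ assign⇓ ⨾⇓ assign⇓ ⨾⇓ run ⨾⇓ assign⇓ ⨾⇓ assign⇓ ⨾⇓
       if⇓ refl (assign⇓ ⨾⇓ assign⇓ ⨾⇓ assign⇓ ⨾⇓ assign⇓) refl)
    where
    r↭r′ = subst (_↭ r′) (++-identityʳ r) eq
    size-eq : suc (measure r′ s) ≡ measure r (a ∷ s)
    size-eq = trans (sym (+-suc _ (length s)))
      (cong (λ l → l + l + suc (length s)) (sym (↭-length r↭r′)))
  ... | _ , Scan.some b {r′} eq hit , run = r′ , b ∷ a ∷ s , o , _ , _ ,
    invariant-push inv hit r↭r′ , size-eq ,
    weaken (extend-time-bound a (unused≤arcs inv) (m≤m+n 2 19))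
      (subtract-spec (idle r (a ∷ s) o p f q) (toℕ (color a)) 1 refl refl ⨾⇓
       assign⇓ ⨾⇓ assign⇓ ⨾⇓ assign⇓ ⨾⇓ assign⇓ ⨾⇓ assign⇓ ⨾⇓ run ⨾⇓ assign⇓ ⨾⇓ assign⇓ ⨾⇓ false⇓ refl)
    where
    r↭r′ = subst (_↭ b ∷ r′) (++-identityʳ r) eq
    lemma : ∀ m n → suc (m + m + suc (suc n)) ≡ suc m + suc m + suc n
    lemma = solve-∀
    size-eq : suc (measure r′ (b ∷ a ∷ s)) ≡ measure r (a ∷ s)
    size-eq = trans (lemma (length r′) (length s))
      (cong (λ l → l + l + suc (length s)) (sym (↭-length r↭r′)))

  tour-time : ℕ → ℕ
  tour-time n = n * (2 + extend-time) + 2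

  tour-spec : ∀ n {r s o} p f q → measure r s ≡ n → Invariant r s o →
    ∃[ r′ ] ∃[ o′ ] ∃[ μ ] (Invariant r′ [] o′ × Memory.out μ ≡ encodeTrail G o′ ×
      ⟨ tour , ⌊ idle r s o p f q ⌋ ⟩⇓ ⌊ μ ⌋ within tour-time n)
  -- The loop stops on an empty stack even if `r` is nonempty, so `n` may be positive here.
  tour-spec n {r} {[]} {o} p f q eq inv =
    r , o , _ , inv , refl , weaken (m≤n+m 2 (n * (2 + extend-time))) (false⇓ refl)
  tour-spec zero {r} {a ∷ s} p f q eq inv
    with () ← trans (sym (+-suc (length r + length r) (length s))) eq
  tour-spec (suc n) {r} {a ∷ s} p f q eq inv
    with r′ , s′ , o′ , f′ , q′ , inv′ , eq′ , run ← extend-spec p f q inv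
    with r″ , o″ , μ , inv″ , out≡ , run′ ← tour-spec n (encodeArcs r′) f′ q′ (suc-injective (trans eq′ eq)) inv′
    = r″ , o″ , μ , inv″ , out≡ ,
      weaken (≤-reflexive (lemma extend-time (n * (2 + extend-time)))) (true⇓ refl run run′)
    where
    lemma : ∀ c d → suc (1 + c + (d + 2)) ≡ 2 + c + d + 2
    lemma = solve-∀

  -- Total running time and correctness of the program.

  total-time : ℕ
  total-time = 27 + tour-time (arcs + arcs)

  total-time≤ : total-time ≤ suc (size G) ^ 3 * 512
  total-time≤ = begin
    total-time
      ≤⟨ +-monoʳ-≤ 27 (+-monoˡ-≤ 2 (*-mono-≤ (+-mono-≤ arcs≤ arcs≤) (+-monoʳ-≤ 2
           (+-mono-≤ (+-monoʳ-≤ 62 (*-monoˡ-≤ 9 z≤))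
             (+-monoˡ-≤ 2 (*-mono-≤ arcs≤ (+-monoʳ-≤ 130 (*-monoˡ-≤ 36 z≤)))))))) ⟩
    polynomial (suc (size G))
      ≤⟨ m≤m+n (polynomial (suc (size G))) (slack (size G)) ⟩
    polynomial (suc (size G)) + slack (size G)
      ≡⟨ lemma (size G) ⟩
    suc (size G) ^ 3 * 512 ∎
    where
    open ≤-Reasoning
    polynomial slack : ℕ → ℕ
    polynomial y = 27 + ((y + y) * (2 + (62 + y * 9 + (y * (130 + y * 36) + 2))) + 2)
    -- The coefficients of `polynomial` sum to 511, so 512 suffices at positive arguments. This is
    -- the difference, expanded at `suc x`, where all its coefficients are natural numbers.
    slack x = 1 + x * 632 + x * x * 1042 + x * x * x * 440
    z≤ : z ≤ suc (size G)
    z≤ = s≤s (m≤m+n vertices arcs)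
    arcs≤ : arcs ≤ suc (size G)
    arcs≤ = ≤-trans (m≤n+m arcs vertices) (n≤1+n (size G))
    lemma : ∀ x →
      27 + ((suc x + suc x) * (2 + (62 + suc x * 9 + (suc x * (130 + suc x * 36) + 2))) + 2) +
      (1 + x * 632 + x * x * 1042 + x * x * x * 440) ≡ suc x * (suc x * (suc x * 1)) * 512
    lemma = solve-∀

  module _ (balanced : ColorBalanced G) (connected : PCTrailConnected G) where

    -- A variable `as` in place of `allFin arcs` permits the case distinction on whether there are
    -- arcs.
    program-spec : ∀ as → as ≡ allFin arcs → ∃[ t ] ∃[ μ ]
      (IsPCEulerTrail G t × Memory.out μ ≡ encodeTrail G t ×
       ⟨ Program.body hierholzer , (encodeℕ vertices · encodeArcs as) Vec.∷ Vec.replicate 10 nil ⟩⇓ ⌊ μ ⌋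
       within total-time)
    program-spec [] eq = [] , _ ,
      (((([] , []) , []) , nothing , nothing) , λ a → subst (a ∈_) (sym eq) (∈-allFin a)) , refl ,
      weaken (≤-trans (m≤m+n 15 12) (m≤m+n 27 _)) (assign⇓ ⨾⇓ assign⇓ ⨾⇓ assign⇓ ⨾⇓ false⇓ refl ⨾⇓ false⇓ refl)
    program-spec (a ∷ r) eq
      with _ , t , μ , inv , out≡ , run ←
        tour-spec (measure r [ a ]) nil nil nil refl (invariant-init eq (colorBalanced⇒balanced balanced))
      = t , μ , invariant-final connected inv , out≡ ,
        weaken (+-monoʳ-≤ 27 (+-monoˡ-≤ 2 (*-monoˡ-≤ (2 + extend-time) steps)))
          (assign⇓ ⨾⇓ assign⇓ ⨾⇓ assign⇓ ⨾⇓ if⇓ refl (assign⇓ ⨾⇓ assign⇓ ⨾⇓ assign⇓) refl ⨾⇓ run)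
      where
      steps : measure r [ a ] ≤ arcs + arcs
      steps = begin
        length r + length r + 1 ≡⟨ +-assoc (length r) (length r) 1 ⟩
        length r + (length r + 1) ≤⟨ +-mono-≤ (n≤1+n (length r)) (≤-reflexive (+-comm (length r) 1)) ⟩
        length (a ∷ r) + length (a ∷ r) ≡⟨ cong (λ as → length as + length as) eq ⟩
        length (allFin arcs) + length (allFin arcs)
          ≡⟨ cong (λ l → l + l) (length-tabulate {n = arcs} (λ i → i)) ⟩
        arcs + arcs ∎
        where open ≤-Reasoning

    construction : ∃[ t ] ∃[ τ ]
      (IsPCEulerTrail G t × Computes hierholzer (encodeGraph G) (encodeTrail G t) τ × τ ≤ total-time)
    construction with t , μ , euler , out≡ , bounded {τ} run τ≤ ← program-spec (allFin arcs) refl =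
      t , τ , euler , (⌊ μ ⌋ , run , out≡) , τ≤

-- The polynomial bound in final form, and the theorem.

-- For positive `x`, doubling dominates the successor, hence the factor 8; the summand 8 covers zero
-- and matches the shape `k * size G ^ d + k`.
suc-cube : ∀ x → suc x ^ 3 ≤ 8 * x ^ 3 + 8
suc-cube zero    = s≤s z≤n
suc-cube (suc w) = m+n≤o⇒m≤o _ (≤-reflexive (lemma w))
  where
  lemma : ∀ w → suc (suc w) * (suc (suc w) * (suc (suc w) * 1)) + (7 * w * w * w + 18 * w * w + 12 * w + 8)
    ≡ 8 * (suc w * (suc w * (suc w * 1))) + 8
  lemma = solve-∀

cubic-bound : ∀ c x → suc x ^ 3 * c ≤ c * 8 * x ^ 3 + c * 8
cubic-bound c x = begin
  suc x ^ 3 * c           ≤⟨ *-monoˡ-≤ c (suc-cube x) ⟩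
  (8 * x ^ 3 + 8) * c     ≡⟨ lemma c (x ^ 3) ⟩
  c * 8 * x ^ 3 + c * 8   ∎
  where
  open ≤-Reasoning
  lemma : ∀ c y → (8 * y + 8) * c ≡ c * 8 * y + c * 8
  lemma = solve-∀

cubic-time : ∃[ c ] (∀ G → Execution.total-time G ≤ suc (size G) ^ 3 * c)
cubic-time = 512 , Execution.total-time≤

cubic-construction : ∀ c → (∀ G → Execution.total-time G ≤ suc (size G) ^ 3 * c) →
  (G : ColoredMultigraph 2) → ColorBalanced G × PCTrailConnected G → ∃[ t ] ∃[ τ ]
    (IsPCEulerTrail G t × Computes hierholzer (encodeGraph G) (encodeTrail G t) τ ×
     τ ≤ c * 8 * size G ^ 3 + c * 8)
cubic-construction c cubic G (bal , conn) with Execution.construction G bal conn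
... | t , τ , euler , computes , τ≤ =
  t , τ , euler , computes , ≤-trans τ≤ (≤-trans (cubic G) (cubic-bound c (size G)))

necessary : (G : ColoredMultigraph 2) → PCEuler G → ColorBalanced G × PCTrailConnected G
necessary G (_ , euler) = balanced , connected
  where open Ports.EulerTrail G euler

sufficient : (G : ColoredMultigraph 2) → ColorBalanced G × PCTrailConnected G → PCEuler G
sufficient G (bal , conn) with Execution.construction G bal conn
... | t , _ , euler , _ = t , euler

theorem1 : ((G : ColoredMultigraph 2) →
    PCEuler G ⇔ (ColorBalanced G × PCTrailConnected G))
    ×
    (∃[ P ] ∃[ k ] ∃[ d ]
    ((G : ColoredMultigraph 2) → PCEuler G →
    ∃[ t ] ∃[ τ ]
    (IsPCEulerTrail G t
    × Computes P (encodeGraph G) (encodeTrail G t) τ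
    × τ ≤ k * size G ^ d + k)))
theorem1 =
  (λ G → mk⇔ (necessary G) (sufficient G)) ,
  hierholzer , proj₁ cubic-time * 8 , 3 ,
  -- The given Euler trail serves only to supply the two conditions under which the program is
  -- correct.
  λ G euler → cubic-construction (proj₁ cubic-time) (proj₂ cubic-time) G (necessary G euler)
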